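{- Let $X$ be a distance-regular graph of diameter $d\geq 2$ with intersection numbers $b_i,c_i$. Let $0\leq j\leq d-2$, assume $b_j>c_{j+1}$, and put $C=b_j/c_{j+1}$. Then for every $1\leq s\leq j+1$, $$b_{j+1}\left(\sum_{t=1}^{s}\frac{1}{b_{t-1}}+\sum_{t=1}^{j+2-s}\frac{1}{b_{t-1}}\right)+c_{j+2}\sum_{t=1}^{j+1}\frac{1}{b_{t-1}}\geq 1-\frac{4}{C-1}.$$
   Context: A connected graph $X$ of diameter $d$ is distance-regular if there are integers $a_i,b_i,c_i$ ($0\le i\le d$) such that for all vertices $v,w$ with $\mathrm{dist}(v,w)=i$, the vertex $w$ has exactly $c_i$ neighbours at distance $i-1$ from $v$, $a_i$ neighbours at distance $i$ from $v$, and $b_i$ neighbours at distance $i+1$ from $v$. Then $X$ is $k$-regular with $k=b_0$, $c_0=b_d=0$, $c_1=1$ and $a_i+b_i+c_i=k$. -}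

module Defs where

open import Data.Fin.Base using (Fin)
open import Data.Fin.Properties using (any?) renaming (_≟_ to _≟ᶠ_)
open import Data.Integer.Base using (+_)
open import Data.List.Base using (allFin; filter; length)
open import Data.Nat.Base using (ℕ; zero; suc; _≤_; _<_; s<s)
open import Data.Nat.Properties using (_≟_)
open import Data.Product.Base using (∃; ∃-syntax; _×_; _,_; proj₁)
open import Data.Rational using (ℚ; 0ℚ; ≢-nonZero; _/_; _÷_) renaming (_+_ to _+ℚ_; _≟_ to _≟ℚ_)
open import Level using (0ℓ)
open import Relation.Binary.Core using (Rel)
open import Relation.Binary.Definitions using (Decidable; Symmetric)
open import Relation.Binary.PropositionalEquality using (_≡_)
open import Relation.Nullary using (¬_; Dec; yes; no)
open import Relation.Nullary.Decidable using (_×-dec_)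
import Relation.Unary as U

record SimpleGraph (n : ℕ) : Set₁ where
  field
    Adj    : Rel (Fin n) 0ℓ
    adj?   : Decidable Adj
    sym    : Symmetric Adj
    irrefl : ∀ v → ¬ Adj v v

IsLeast : (ℕ → Set) → ℕ → Set
IsLeast P m = P m × (∀ i → i < m → ¬ P i)

least : {P : ℕ → Set} → U.Decidable P → ∃ P → ∃ (IsLeast P)
least {P} P? (k , p) = go P? k p
  where
  go : {Q : ℕ → Set} → U.Decidable Q → ∀ k → Q k → ∃ (IsLeast Q)
  go Q? zero q = zero , q , λ _ ()
  go {Q} Q? (suc k) q with Q? zero
  ... | yes q₀ = zero , q₀ , λ _ ()
  ... | no ¬q₀ with go {λ i → Q (suc i)} (λ i → Q? (suc i)) k q
  ...   | m , qm , below = suc m , qm , below′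
    where
    below′ : ∀ i → i < suc m → ¬ Q i
    below′ zero    _         = ¬q₀
    below′ (suc i) (s<s i<m) = below i i<m

module _ {n : ℕ} (X : SimpleGraph n) where
  open SimpleGraph X

  Walk : ℕ → Fin n → Fin n → Set
  Walk zero    v w = v ≡ w
  Walk (suc k) v w = ∃[ u ] (Adj v u × Walk k u w)

  walk? : ∀ k v w → Dec (Walk k v w)
  walk? zero    v w = v ≟ᶠ w
  walk? (suc k) v w = any? (λ u → adj? v u ×-dec walk? k u w)

  Connected : Set
  Connected = ∀ v w → ∃[ k ] Walk k v w

  distance : Connected → ∀ v w → ∃ (IsLeast (λ k → Walk k v w))
  distance conn v w = least (λ k → walk? k v w) (conn v w)

  dist : Connected → Fin n → Fin n → ℕ
  dist conn v w = proj₁ (distance conn v w)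

  #neighbours : Fin n → {P : Fin n → Set} → U.Decidable P → ℕ
  #neighbours w P? = length (filter (λ u → adj? w u ×-dec P? u) (allFin n))

  HasDiameter : Connected → ℕ → Set
  HasDiameter conn d =
    (∀ v w → dist conn v w ≤ d) × (∃[ v ] ∃[ w ] dist conn v w ≡ d)

  -- Only the values a i, b i, c i with i ≤ d are constrained: by hasDiameter,
  -- the distances that occur are exactly 0, …, d. "At distance i - 1" is
  -- written suc (dist v u) ≡ i, so that c 0 counts nothing.
  record IsDistanceRegular (d : ℕ) (a b c : ℕ → ℕ) : Set where
    field
      connected   : Connected
      hasDiameter : HasDiameter connected d
      c-count : ∀ i v w → dist connected v w ≡ i →
                #neighbours w (λ u → suc (dist connected v u) ≟ i) ≡ c i
      a-count : ∀ i v w → dist connected v w ≡ i →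
                #neighbours w (λ u → dist connected v u ≟ i) ≡ a i
      b-count : ∀ i v w → dist connected v w ≡ i →
                #neighbours w (λ u → dist connected v u ≟ suc i) ≡ b i

fromℕ : ℕ → ℚ
fromℕ m = + m / 1

infixl 7 _⊘_

-- Division made total by p ⊘ 0 = 0. For a distance-regular graph of diameter d
-- the convention is not reached when dividing by b i with i < d or by c i with
-- 1 ≤ i ≤ d, as these are positive (follow a geodesic of length d).
_⊘_ : ℚ → ℚ → ℚ
p ⊘ q with q ≟ℚ 0ℚ
... | yes _  = 0ℚ
... | no q≢0 = _÷_ p q {{≢-nonZero q≢0}}

-- sumFrom1 m f = f 1 + … + f m
sumFrom1 : ℕ → (ℕ → ℚ) → ℚ
sumFrom1 zero    f = 0ℚ
sumFrom1 (suc m) f = sumFrom1 m f +ℚ f (suc m)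

infix 5 sumFrom1
syntax sumFrom1 m (λ t → e) = Σ[1≤ t ≤ m ] e

{-# OPTIONS --safe #-}
-- Put m = j + 1 and take v, u at distance j + 2 and y on a geodesic between
-- them, at distance s from u. A vertex z of the sphere S_m(y) is of one of four kinds.
-- If δ(u,z) > m then along the geodesic from y to u there is an arc (x, x′) with
-- δ(x,z) = m and δ(x′,z) = m + 1; each arc has k_m b_m / b_0 such z, so these
-- are at most a fraction s b_m / b_0 ≤ b_m Σ_{t ≤ s} 1 / b_{t-1} of S_m(y).
-- The case δ(v,z) > m is the same. If δ(u,z) = m and δ(v,z) ≤ m, reach z by a random
-- geodesic from u: it starts at distance m + 1 from v, and its t-th step enters
-- the m-ball of v with probability at most c_{m+1} / b_{t-1}. Finally δ(u,z) < m
-- accounts for at most k_m / (C - 1) vertices, as k_{i+1} ≥ C k_i for i ≤ j.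
module Submission where

open import Defs
open import Data.Bool.Base using (true; false; if_then_else_)
open import Data.Empty using (⊥; ⊥-elim)
open import Data.Fin.Base using (Fin; zero; suc)
import Data.Integer.Base as ℤ
import Data.Integer.Properties as ℤ
open import Data.List.Base using (allFin; filter; length; tabulate)
open import Data.List.Membership.Propositional using (lose)
open import Data.List.Membership.Propositional.Properties using (∈-allFin)
open import Data.List.Properties using (filter-none; filter-some)
open import Data.List.Relation.Unary.All as All using (All; []; _∷_)
open import Data.List.Relation.Unary.All.Properties using (all-filter)
open import Data.List.Relation.Unary.AllPairs using (_∷_)
open import Data.List.Relation.Unary.Unique.Propositional using (Unique)
open import Data.List.Relation.Unary.Unique.Propositional.Properties using (allFin⁺; filter⁺)
open import Data.Nat.Base using (ℕ; zero; suc; _+_; _*_; _∸_; _≤_; _<_; z≤n; s≤s; >-nonZero)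
import Data.Nat.Coprimality as Coprimality
open import Data.Nat.Properties
open import Data.Product.Base using (∃-syntax; _×_; _,_; proj₁; proj₂)
open import Data.Rational as ℚ using (ℚ; mkℚ; 0ℚ; 1ℚ; Positive; NonNegative; positive; nonNegative; *≤*)
import Data.Rational.Properties as ℚ
open import Data.Rational.Solver using (module +-*-Solver)
open import Data.Sum.Base using (_⊎_; inj₁; inj₂)
open import Function.Base using (_∘_)
open import Relation.Binary.PropositionalEquality
open import Relation.Nullary using (¬_; Dec; yes; no; does)
open import Relation.Nullary.Decidable using (_×-dec_; _⊎-dec_)
import Relation.Unary as U

open import Algebra.Properties.Semiring.Sum +-*-semiring using (sum; sum-syntax; ∑-comm; ∑-distrib-+; sum-cong-≗; *-distribˡ-sum; *-distribʳ-sum)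

-- Rational arithmetic

-- For a variable `m` the fraction `+ m / 1` is blocked on a gcd. In this normal form numerator and
-- denominator compute, and the next lemmas reduce to facts about integers.
fromℕ-mkℚ : ∀ m → fromℕ m ≡ mkℚ (ℤ.+ m) 0 (Coprimality.sym (Coprimality.1-coprimeTo m))
fromℕ-mkℚ m = ℚ.normalize-coprime (Coprimality.sym (Coprimality.1-coprimeTo m))

fromℕ-homo-+ : ∀ m n → fromℕ (m + n) ≡ fromℕ m ℚ.+ fromℕ n
fromℕ-homo-+ m n rewrite fromℕ-mkℚ m | fromℕ-mkℚ n =
  cong (ℚ._/ 1) (sym (cong₂ ℤ._+_ (ℤ.*-identityʳ (ℤ.+ m)) (ℤ.*-identityʳ (ℤ.+ n))))

fromℕ-homo-* : ∀ m n → fromℕ (m * n) ≡ fromℕ m ℚ.* fromℕ n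
fromℕ-homo-* m n rewrite fromℕ-mkℚ m | fromℕ-mkℚ n = cong (ℚ._/ 1) (ℤ.pos-* m n)

fromℕ-mono-≤ : ∀ {m n} → m ≤ n → fromℕ m ℚ.≤ fromℕ n
fromℕ-mono-≤ {m} {n} m≤n rewrite fromℕ-mkℚ m | fromℕ-mkℚ n =
  *≤* (ℤ.*-monoʳ-≤-nonNeg (ℤ.+ 1) (ℤ.+≤+ m≤n))

fromℕ-nonNeg : ∀ m → NonNegative (fromℕ m)
fromℕ-nonNeg m = ℚ.normalize-nonNeg m 1

fromℕ-pos : ∀ {m} → 0 < m → Positive (fromℕ m)
fromℕ-pos {m} 0<m = ℚ.normalize-pos m 1 {{_}} {{>-nonZero 0<m}}

-- Positivity of `q` excludes the default value of `⊘`. Every later use of a quotient goes through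
-- this identity.
q*p⊘q≡p : ∀ p q .{{_ : Positive q}} → q ℚ.* (p ⊘ q) ≡ p
q*p⊘q≡p p q with q ℚ.≟ 0ℚ
... | yes refl = ⊥-elim (ℚ.<-irrefl refl (ℚ.positive⁻¹ q))
... | no q≢0 = begin
  q ℚ.* (p ℚ.* ℚ.1/ q)    ≡⟨ solve 3 (λ q p r → q :* (p :* r) := p :* (q :* r)) refl q p (ℚ.1/ q) ⟩
  p ℚ.* (q ℚ.* ℚ.1/ q)    ≡⟨ cong (p ℚ.*_) (ℚ.*-inverseʳ q) ⟩
  p ℚ.* 1ℚ                ≡⟨ ℚ.*-identityʳ p ⟩
  p                       ∎
  where
  open ≡-Reasoning
  open +-*-Solver
  instance _ = ℚ.≢-nonZero q≢0

⊘-nonNeg : ∀ p q .{{_ : NonNegative p}} .{{_ : Positive q}} → NonNegative (p ⊘ q)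
⊘-nonNeg p q = nonNegative (ℚ.*-cancelˡ-≤-pos q (begin
  q ℚ.* 0ℚ       ≡⟨ ℚ.*-zeroʳ q ⟩
  0ℚ             ≤⟨ ℚ.nonNegative⁻¹ p ⟩
  p              ≡⟨ q*p⊘q≡p p q ⟨
  q ℚ.* (p ⊘ q)  ∎))
  where open ℚ.≤-Reasoning

-- Counting vertices and edges

𝟙 : {A : Set} → Dec A → ℕ
𝟙 A? = if does A? then 1 else 0

𝟙-×-dec : {A B : Set} (A? : Dec A) (B? : Dec B) → 𝟙 (A? ×-dec B?) ≡ 𝟙 A? * 𝟙 B?
𝟙-×-dec (yes _) B? = sym (*-identityˡ (𝟙 B?))
𝟙-×-dec (no _)  B? = refl

𝟙-cong : {A B : Set} (A? : Dec A) (B? : Dec B) → (A → B) → (B → A) → 𝟙 A? ≡ 𝟙 B?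
𝟙-cong (yes _) (yes _) f g = refl
𝟙-cong (yes a) (no ¬b) f g = ⊥-elim (¬b (f a))
𝟙-cong (no ¬a) (yes b) f g = ⊥-elim (¬a (g b))
𝟙-cong (no _)  (no _)  f g = refl

𝟙-⊎ : {A B C : Set} (A? : Dec A) (B? : Dec B) (C? : Dec C) →
      (A → B ⊎ C) → 𝟙 A? ≤ 𝟙 B? + 𝟙 C?
𝟙-⊎ (no _)  _       _       f = z≤n
𝟙-⊎ (yes _) (yes _) _       f = s≤s z≤n
𝟙-⊎ (yes _) (no _)  (yes _) f = s≤s z≤n
𝟙-⊎ (yes a) (no ¬b) (no ¬c) f with f a
... | inj₁ b = ⊥-elim (¬b b)
... | inj₂ c = ⊥-elim (¬c c)

𝟙*-mono-≤ : {A : Set} (A? : Dec A) {k l : ℕ} → (A → k ≤ l) → 𝟙 A? * k ≤ 𝟙 A? * l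
𝟙*-mono-≤ (yes a) f = *-monoʳ-≤ 1 (f a)
𝟙*-mono-≤ (no _)  f = z≤n

∑-mono-≤ : ∀ {n} {f g : Fin n → ℕ} → (∀ i → f i ≤ g i) → sum f ≤ sum g
∑-mono-≤ {zero}  f≤g = z≤n
∑-mono-≤ {suc n} f≤g = +-mono-≤ (f≤g zero) (∑-mono-≤ (f≤g ∘ suc))

-- Turns the filtered lists of the definitions into sums, whose order can be exchanged. The function
-- `f` is arbitrary because the recursion replaces it by `f ∘ suc`.
length-filter-tabulate : ∀ {n} {A : Set} {P : A → Set} (P? : U.Decidable P) (f : Fin n → A) →
                         length (filter P? (tabulate f)) ≡ ∑[ i < n ] 𝟙 (P? (f i))
length-filter-tabulate {zero}  P? f = refl
length-filter-tabulate {suc n} P? f with does (P? (f zero))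
... | true  = cong suc (length-filter-tabulate P? (f ∘ suc))
... | false = length-filter-tabulate P? (f ∘ suc)

module _ {n : ℕ} where

  count : {P : Fin n → Set} → U.Decidable P → ℕ
  count P? = length (filter P? (allFin n))

  count-∑ : {P : Fin n → Set} (P? : U.Decidable P) → count P? ≡ ∑[ i < n ] 𝟙 (P? i)
  count-∑ P? = length-filter-tabulate P? (λ i → i)

  count-∪ : {P Q R : Fin n → Set} (P? : U.Decidable P) (Q? : U.Decidable Q) (R? : U.Decidable R) →
            (∀ x → P x → Q x ⊎ R x) → count P? ≤ count Q? + count R?
  count-∪ P? Q? R? P⊆Q∪R = begin
    count P?                                        ≡⟨ count-∑ P? ⟩
    ∑[ i < n ] 𝟙 (P? i)                             ≤⟨ ∑-mono-≤ (λ i → 𝟙-⊎ (P? i) (Q? i) (R? i) (P⊆Q∪R i)) ⟩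
    ∑[ i < n ] (𝟙 (Q? i) + 𝟙 (R? i))                ≡⟨ ∑-distrib-+ (𝟙 ∘ Q?) (𝟙 ∘ R?) ⟩
    (∑[ i < n ] 𝟙 (Q? i)) + (∑[ i < n ] 𝟙 (R? i))  ≡⟨ cong₂ _+_ (count-∑ Q?) (count-∑ R?) ⟨
    count Q? + count R?                             ∎
    where open ≤-Reasoning

  count-∅ : {P : Fin n → Set} (P? : U.Decidable P) → (∀ x → ¬ P x) → count P? ≡ 0
  count-∅ P? ¬P = cong length (filter-none P? (All.universal ¬P (allFin n)))

  count-⊆ : {P Q : Fin n → Set} (P? : U.Decidable P) (Q? : U.Decidable Q) →
            (∀ x → P x → Q x) → count P? ≤ count Q?
  count-⊆ P? Q? P⊆Q = begin
    count P?             ≤⟨ count-∪ P? Q? ∅? (λ x → inj₁ ∘ P⊆Q x) ⟩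
    count Q? + count ∅?  ≡⟨ cong (count Q? +_) (count-∅ ∅? (λ _ ())) ⟩
    count Q? + 0         ≡⟨ +-identityʳ _ ⟩
    count Q?             ∎
    where
    open ≤-Reasoning
    ∅? : U.Decidable {A = Fin n} (λ _ → ⊥)
    ∅? _ = no λ ()

  count-pos : {P : Fin n → Set} (P? : U.Decidable P) {x : Fin n} → P x → 0 < count P?
  count-pos P? {x} Px = filter-some P? (lose (∈-allFin x) Px)

  count-unique : {P : Fin n → Set} (P? : U.Decidable P) →
                 (∀ {x y} → P x → P y → x ≡ y) → count P? ≤ 1
  count-unique {P} P? P-unique = go (all-filter P? (allFin n)) (filter⁺ P? (allFin⁺ n))
    where
    go : ∀ {xs} → All P xs → Unique xs → length xs ≤ 1
    go []           _                 = z≤n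
    go (_ ∷ [])     _                 = s≤s z≤n
    go (p ∷ q ∷ _) ((x≢y ∷ _) ∷ _) = ⊥-elim (x≢y (P-unique p q))

module _ {n : ℕ} (X : SimpleGraph n) where
  open SimpleGraph X renaming (sym to adj-sym)

  -- The number of adjacent pairs from P to Q, grouped by the first vertex so that bounds on
  -- `#neighbours` apply term by term.
  edges : {P Q : Fin n → Set} → U.Decidable P → U.Decidable Q → ℕ
  edges P? Q? = ∑[ x < n ] (𝟙 (P? x) * #neighbours X x Q?)

  edges-∑∑ : {P Q : Fin n → Set} (P? : U.Decidable P) (Q? : U.Decidable Q) →
             edges P? Q? ≡ ∑[ x < n ] ∑[ y < n ] (𝟙 (P? x) * (𝟙 (adj? x y) * 𝟙 (Q? y)))
  edges-∑∑ P? Q? = sum-cong-≗ λ x → trans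
    (cong (𝟙 (P? x) *_) (trans (count-∑ (λ y → adj? x y ×-dec Q? y))
                                (sum-cong-≗ λ y → 𝟙-×-dec (adj? x y) (Q? y))))
    (*-distribˡ-sum (𝟙 (P? x)) (λ y → 𝟙 (adj? x y) * 𝟙 (Q? y)))

  -- Double counting: since adjacency is symmetric, the pairs can be grouped by either end. The
  -- estimates below bound such a count from below at one end and from above at the other.
  edges-comm : {P Q : Fin n → Set} (P? : U.Decidable P) (Q? : U.Decidable Q) →
               edges P? Q? ≡ edges Q? P?
  edges-comm P? Q? = begin
    edges P? Q?                                                  ≡⟨ edges-∑∑ P? Q? ⟩
    ∑[ x < n ] ∑[ y < n ] (𝟙 (P? x) * (𝟙 (adj? x y) * 𝟙 (Q? y)))  ≡⟨ ∑-comm (λ x y → 𝟙 (P? x) * (𝟙 (adj? x y) * 𝟙 (Q? y))) ⟩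
    ∑[ y < n ] ∑[ x < n ] (𝟙 (P? x) * (𝟙 (adj? x y) * 𝟙 (Q? y)))  ≡⟨ sum-cong-≗ (λ y → sum-cong-≗ λ x → swap x y) ⟩
    ∑[ y < n ] ∑[ x < n ] (𝟙 (Q? y) * (𝟙 (adj? y x) * 𝟙 (P? x)))  ≡⟨ edges-∑∑ Q? P? ⟨
    edges Q? P?                                                  ∎
    where
    open ≡-Reasoning
    swap : ∀ x y → 𝟙 (P? x) * (𝟙 (adj? x y) * 𝟙 (Q? y)) ≡ 𝟙 (Q? y) * (𝟙 (adj? y x) * 𝟙 (P? x))
    swap x y = begin
      𝟙 (P? x) * (𝟙 (adj? x y) * 𝟙 (Q? y))  ≡⟨ *-comm (𝟙 (P? x)) _ ⟩
      𝟙 (adj? x y) * 𝟙 (Q? y) * 𝟙 (P? x)    ≡⟨ cong (_* 𝟙 (P? x)) (*-comm (𝟙 (adj? x y)) _) ⟩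
      𝟙 (Q? y) * 𝟙 (adj? x y) * 𝟙 (P? x)    ≡⟨ *-assoc (𝟙 (Q? y)) _ _ ⟩
      𝟙 (Q? y) * (𝟙 (adj? x y) * 𝟙 (P? x))  ≡⟨ cong (λ a → 𝟙 (Q? y) * (a * 𝟙 (P? x))) (𝟙-cong (adj? x y) (adj? y x) adj-sym adj-sym) ⟩
      𝟙 (Q? y) * (𝟙 (adj? y x) * 𝟙 (P? x))  ∎

  count-*-∑ : {P : Fin n → Set} (P? : U.Decidable P) (k : ℕ) →
              count P? * k ≡ ∑[ x < n ] (𝟙 (P? x) * k)
  count-*-∑ P? k = trans (cong (_* k) (count-∑ P?)) (*-distribʳ-sum k (𝟙 ∘ P?))

  edges-≤ : {P Q : Fin n → Set} (P? : U.Decidable P) (Q? : U.Decidable Q) {k : ℕ} →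
            (∀ x → P x → #neighbours X x Q? ≤ k) → edges P? Q? ≤ count P? * k
  edges-≤ P? Q? {k} bound = ≤-trans (∑-mono-≤ λ x → 𝟙*-mono-≤ (P? x) (bound x))
                                    (≤-reflexive (sym (count-*-∑ P? k)))

  edges-≥ : {P Q : Fin n → Set} (P? : U.Decidable P) (Q? : U.Decidable Q) {k : ℕ} →
            (∀ x → P x → k ≤ #neighbours X x Q?) → count P? * k ≤ edges P? Q?
  edges-≥ P? Q? {k} bound = ≤-trans (≤-reflexive (count-*-∑ P? k))
                                    (∑-mono-≤ λ x → 𝟙*-mono-≤ (P? x) (bound x))

  edges-≡ : {P Q : Fin n → Set} (P? : U.Decidable P) (Q? : U.Decidable Q) {k : ℕ} →
            (∀ x → P x → #neighbours X x Q? ≡ k) → edges P? Q? ≡ count P? * k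
  edges-≡ P? Q? eq = ≤-antisym (edges-≤ P? Q? λ x → ≤-reflexive ∘ eq x)
                               (edges-≥ P? Q? λ x → ≤-reflexive ∘ sym ∘ eq x)

  edges-∪ˡ : {P Q R S : Fin n → Set} (P? : U.Decidable P) (Q? : U.Decidable Q)
             (R? : U.Decidable R) (S? : U.Decidable S) →
             (∀ x → P x → Q x ⊎ R x) → edges P? S? ≤ edges Q? S? + edges R? S?
  edges-∪ˡ P? Q? R? S? P⊆Q∪R = begin
    edges P? S?
      ≤⟨ ∑-mono-≤ (λ x → *-monoˡ-≤ (ν x) (𝟙-⊎ (P? x) (Q? x) (R? x) (P⊆Q∪R x))) ⟩
    ∑[ x < n ] ((𝟙 (Q? x) + 𝟙 (R? x)) * ν x)
      ≡⟨ sum-cong-≗ (λ x → *-distribʳ-+ (ν x) (𝟙 (Q? x)) (𝟙 (R? x))) ⟩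
    ∑[ x < n ] (𝟙 (Q? x) * ν x + 𝟙 (R? x) * ν x)
      ≡⟨ ∑-distrib-+ (λ x → 𝟙 (Q? x) * ν x) (λ x → 𝟙 (R? x) * ν x) ⟩
    edges Q? S? + edges R? S? ∎
    where
    open ≤-Reasoning
    ν : Fin n → ℕ
    ν x = #neighbours X x S?

  #neighbours-⊆ : (w : Fin n) {P Q : Fin n → Set} (P? : U.Decidable P) (Q? : U.Decidable Q) →
                  (∀ u → Adj w u → P u → Q u) → #neighbours X w P? ≤ #neighbours X w Q?
  #neighbours-⊆ w P? Q? P⊆Q = count-⊆ (λ u → adj? w u ×-dec P? u) (λ u → adj? w u ×-dec Q? u)
                                      (λ u (a , p) → a , P⊆Q u a p)

-- Distance-regular graphs

module _ {n : ℕ} (X : SimpleGraph n) where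
  open SimpleGraph X renaming (sym to adj-sym)

  walk-snoc : ∀ k {u v w} → Walk X k u v → Adj v w → Walk X (suc k) u w
  walk-snoc zero    refl        a = _ , a , refl
  walk-snoc (suc k) (x , e , p) a = x , e , walk-snoc k p a

  walk-unsnoc : ∀ k {u w} → Walk X (suc k) u w → ∃[ v ] (Walk X k u v × Adj v w)
  walk-unsnoc zero    (x , a , refl) = _ , refl , a
  walk-unsnoc (suc k) (x , a , p) with walk-unsnoc k p
  ... | v , q , e = v , (x , a , q) , e

  walk-reverse : ∀ k {u v} → Walk X k u v → Walk X k v u
  walk-reverse zero    p           = sym p
  walk-reverse (suc k) (x , a , p) = walk-snoc k (walk-reverse k p) (adj-sym a)

  walk-split : ∀ k l {u w} → Walk X (k + l) u w → ∃[ v ] (Walk X k u v × Walk X l v w)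
  walk-split zero    l p = _ , refl , p
  walk-split (suc k) l (x , a , p) with walk-split k l p
  ... | v , q , r = v , (x , a , q) , r

module DistanceRegular {n : ℕ} (X : SimpleGraph n) {d : ℕ} {a b c : ℕ → ℕ}
                       (D : IsDistanceRegular X d a b c) where
  open SimpleGraph X renaming (sym to adj-sym)
  open IsDistanceRegular D

  δ : Fin n → Fin n → ℕ
  δ = dist X connected

  δ-walk : ∀ v w → Walk X (δ v w) v w
  δ-walk v w = proj₁ (proj₂ (distance X connected v w))

  δ-min : ∀ {k v w} → Walk X k v w → δ v w ≤ k
  δ-min {k} {v} {w} p = ≮⇒≥ λ k<δ → proj₂ (proj₂ (distance X connected v w)) k k<δ p

  δ-stepˡ : ∀ {x y} z → Adj x y → δ x z ≤ suc (δ y z)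
  δ-stepˡ z x~y = δ-min (_ , x~y , δ-walk _ z)

  δ-stepʳ : ∀ x {y z} → Adj z y → δ x z ≤ suc (δ x y)
  δ-stepʳ x {y} z~y = δ-min (walk-snoc X (δ x y) (δ-walk x y) (adj-sym z~y))

  δ≡0⇒≡ : ∀ {v w} → δ v w ≡ 0 → v ≡ w
  δ≡0⇒≡ {v} {w} δ≡0 = subst (λ k → Walk X k v w) δ≡0 (δ-walk v w)

  δ-refl : ∀ v → δ v v ≡ 0
  δ-refl v = n≤0⇒n≡0 (δ-min refl)

  -- Take the last vertex but one of a shortest walk; were it closer to `v`, then `w` would be
  -- closer too.
  geodesic-init : ∀ {v w i} → δ v w ≡ suc i → ∃[ u ] (Adj w u × δ v u ≡ i)
  geodesic-init {v} {w} {i} δ≡ with walk-unsnoc X i (subst (λ k → Walk X k v w) δ≡ (δ-walk v w))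
  ... | u , p , u~w = u , w~u , ≤-antisym (δ-min p) (≤-pred (≤-trans (≤-reflexive (sym δ≡)) (δ-stepʳ v w~u)))
    where w~u = adj-sym u~w

  geodesic-tail : ∀ {v w i} → δ v w ≡ suc i → ∃[ u ] (Adj v u × δ u w ≡ i)
  geodesic-tail {v} {w} δ≡ with subst (λ k → Walk X k v w) δ≡ (δ-walk v w)
  ... | u , v~u , p = u , v~u , ≤-antisym (δ-min p) (≤-pred (≤-trans (≤-reflexive (sym δ≡)) (δ-stepˡ w v~u)))

  -- Start from a pair at distance d and drop the last d - i vertices of a geodesic.
  distance-attained : ∀ {i} → i ≤ d → ∃[ v ] ∃[ w ] δ v w ≡ i
  distance-attained {i} i≤d with proj₂ hasDiameter
  ... | v , w , δ≡d = descend (d ∸ i) w (trans δ≡d (sym (m∸n+n≡m i≤d)))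
    where
    descend : ∀ k w → δ v w ≡ k + i → ∃[ v ] ∃[ w ] δ v w ≡ i
    descend zero    w δ≡ = v , w , δ≡
    descend (suc k) w δ≡ with geodesic-init δ≡
    ... | u , _ , δ≡′ = descend k u δ≡′

  -- Intersection numbers and sphere sizes

  layer? : ∀ v i → U.Decidable (λ z → δ v z ≡ i)
  layer? v i z = δ v z ≟ i

  κ : Fin n → ℕ → ℕ
  κ v i = count (layer? v i)

  c-count-layer : ∀ {i} v w → δ v w ≡ suc i → #neighbours X w (layer? v i) ≡ c (suc i)
  c-count-layer {i} v w δ≡ = trans
    (≤-antisym (#neighbours-⊆ X w (layer? v i) (λ u → suc (δ v u) ≟ suc i) (λ _ _ → cong suc))
               (#neighbours-⊆ X w (λ u → suc (δ v u) ≟ suc i) (layer? v i) (λ _ _ → suc-injective)))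
    (c-count (suc i) v w δ≡)

  -- On a geodesic of length i + 1 the last vertex is a neighbour of the one before it and one step
  -- farther from the start. By regularity a single such pair suffices.
  b-pos : ∀ {i} → i < d → 0 < b i
  b-pos {i} i<d with distance-attained i<d
  ... | v , w , δ≡ with geodesic-init δ≡
  ...   | u , w~u , δ≡′ = subst (0 <_) (b-count i v u δ≡′)
                            (count-pos (λ z → adj? u z ×-dec layer? v (suc i) z) (adj-sym w~u , δ≡))

  c-pos : ∀ {i} → i < d → 0 < c (suc i)
  c-pos {i} i<d with distance-attained i<d
  ... | v , w , δ≡ with geodesic-init δ≡
  ...   | u , w~u , δ≡′ = subst (0 <_) (c-count-layer v w δ≡)
                            (count-pos (λ z → adj? w z ×-dec layer? v i z) (w~u , δ≡′))

  -- Move `v` one step towards `w` along a geodesic. A neighbour of `w` that is farther than `w`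
  -- from `v` is then also farther than `w` from `v′`.
  b-antitone-step : ∀ {i} → i < d → b (suc i) ≤ b i
  b-antitone-step {i} i<d with distance-attained i<d
  ... | v , w , δ≡ with geodesic-tail δ≡
  ...   | v′ , v~v′ , δ′≡ = subst₂ _≤_ (b-count (suc i) v w δ≡) (b-count i v′ w δ′≡)
    (#neighbours-⊆ X w (layer? v (2 + i)) (layer? v′ (suc i)) λ u w~u δu≡ →
      ≤-antisym (≤-trans (δ-stepʳ v′ (adj-sym w~u)) (≤-reflexive (cong suc δ′≡)))
                (≤-pred (≤-trans (≤-reflexive (sym δu≡)) (δ-stepˡ u v~v′))))

  -- If `v′` follows `v` on a geodesic to `w`, a neighbour of `w` that is nearer to `v′` is nearer
  -- to `v` as well.
  c-monotone-step : ∀ {i} → i < d → c i ≤ c (suc i)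
  c-monotone-step {i} i<d with distance-attained i<d
  ... | v , w , δ≡ with geodesic-tail δ≡
  ...   | v′ , v~v′ , δ′≡ = subst₂ _≤_ (c-count i v′ w δ′≡) (c-count-layer v w δ≡)
    (#neighbours-⊆ X w (λ u → suc (δ v′ u) ≟ i) (layer? v i) λ u w~u δu≡ →
      ≤-antisym (≤-trans (δ-stepˡ u v~v′) (≤-reflexive δu≡))
                (≤-pred (≤-trans (≤-reflexive (sym δ≡)) (δ-stepʳ v w~u))))

  b-antitone : ∀ {i j} → i ≤ j → j ≤ d → b j ≤ b i
  b-antitone {i} {j} i≤j j≤d with m≤n⇒m<n∨m≡n i≤j
  ... | inj₂ refl = ≤-refl
  b-antitone {i} {suc j} i≤j j≤d | inj₁ (s≤s i≤j′) =
    ≤-trans (b-antitone-step j≤d) (b-antitone i≤j′ (<⇒≤ j≤d))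

  c-monotone : ∀ {i j} → i ≤ j → j ≤ d → c i ≤ c j
  c-monotone {i} {j} i≤j j≤d with m≤n⇒m<n∨m≡n i≤j
  ... | inj₂ refl = ≤-refl
  c-monotone {i} {suc j} i≤j j≤d | inj₁ (s≤s i≤j′) =
    ≤-trans (c-monotone i≤j′ (<⇒≤ j≤d)) (c-monotone-step j≤d)

  -- Both sides count the edges between the spheres of radius i and i + 1 about `v`.
  κ-rec : ∀ v i → κ v i * b i ≡ κ v (suc i) * c (suc i)
  κ-rec v i = begin
    κ v i * b i              ≡⟨ edges-≡ X (layer? v i) (layer? v (suc i)) (b-count i v) ⟨
    edges X (layer? v i) (layer? v (suc i))
                             ≡⟨ edges-comm X (layer? v i) (layer? v (suc i)) ⟩
    edges X (layer? v (suc i)) (layer? v i)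
                             ≡⟨ edges-≡ X (layer? v (suc i)) (layer? v i) (c-count-layer v) ⟩
    κ v (suc i) * c (suc i)  ∎
    where open ≡-Reasoning

  κ-zero : ∀ v → κ v 0 ≡ 1
  κ-zero v = ≤-antisym (count-unique (layer? v 0) λ p q → trans (sym (δ≡0⇒≡ p)) (δ≡0⇒≡ q))
                       (count-pos (layer? v 0) (δ-refl v))

  -- `κ-rec` determines the sizes one after another from `κ-zero`, as the positive `c (suc i)` can
  -- be cancelled.
  κ-const : ∀ i v w → i ≤ d → κ v i ≡ κ w i
  κ-const zero    v w _   = trans (κ-zero v) (sym (κ-zero w))
  κ-const (suc i) v w i<d = *-cancelʳ-≡ _ _ (c (suc i)) {{>-nonZero (c-pos i<d)}} (begin
    κ v (suc i) * c (suc i)  ≡⟨ κ-rec v i ⟨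
    κ v i * b i              ≡⟨ cong (_* b i) (κ-const i v w (<⇒≤ i<d)) ⟩
    κ w i * b i              ≡⟨ κ-rec w i ⟩
    κ w (suc i) * c (suc i)  ∎)
    where open ≡-Reasoning

  κ-pos : ∀ {i} v → i ≤ d → 0 < κ v i
  κ-pos {i} v i≤d with distance-attained i≤d
  ... | u , w , δ≡ = subst (0 <_) (κ-const i u v i≤d) (count-pos (layer? u i) δ≡)

  -- Open balls

  ball? : ∀ v i → U.Decidable (λ z → δ v z < i)
  ball? v i z = δ v z <? i

  -- A geometric series with denominators cleared: up to radius j + 1 each sphere is at least C =
  -- b_j / c_{j+1} times the previous one, so the spheres of radius below i sum to at most κ_i / (C
  -- - 1).
  ball-bound : ∀ {j} v i → j < d → i ≤ suc j → c (suc j) ≤ b j →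
               count (ball? v i) * (b j ∸ c (suc j)) ≤ κ v i * c (suc j)
  ball-bound {j} v zero    _   _         _   rewrite count-∅ (ball? v 0) (λ _ ()) = z≤n
  ball-bound {j} v (suc i) j<d (s≤s i≤j) c≤b = begin
    count (ball? v (suc i)) * e              ≤⟨ *-monoˡ-≤ e (count-∪ (ball? v (suc i)) (ball? v i) (layer? v i) (λ _ → m≤n⇒m<n∨m≡n ∘ ≤-pred)) ⟩
    (count (ball? v i) + κ v i) * e          ≡⟨ *-distribʳ-+ e (count (ball? v i)) _ ⟩
    count (ball? v i) * e + κ v i * e        ≤⟨ +-monoˡ-≤ (κ v i * e) (ball-bound v i j<d (m≤n⇒m≤1+n i≤j) c≤b) ⟩
    κ v i * c (suc j) + κ v i * e            ≡⟨ *-distribˡ-+ (κ v i) (c (suc j)) e ⟨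
    -- The induction hypothesis has supplied exactly the `c (suc j)` that completes `e` to `b j`.
    κ v i * (c (suc j) + e)                  ≡⟨ cong (κ v i *_) (m+[n∸m]≡n c≤b) ⟩
    κ v i * b j                              ≤⟨ *-monoʳ-≤ (κ v i) (b-antitone i≤j (<⇒≤ j<d)) ⟩
    κ v i * b i                              ≡⟨ κ-rec v i ⟩
    κ v (suc i) * c (suc i)                  ≤⟨ *-monoʳ-≤ (κ v (suc i)) (c-monotone (s≤s i≤j) j<d) ⟩
    κ v (suc i) * c (suc j)                  ∎
    where
    open ≤-Reasoning
    e = b j ∸ c (suc j)

  -- Leaving a ball along a walk

  receding? : ∀ x y m → U.Decidable (λ z → δ x z ≡ m × δ y z ≡ suc m)
  receding? x y m z = (δ x z ≟ m) ×-dec (δ y z ≟ suc m)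

  -- Let z be at distance m + 1 from `x` and m + 2 from `y`. Its c_{m+1} neighbours nearer to `x`
  -- are all at distance m + 1 from `y`, hence in `Q?`. Conversely, a vertex of `Q?` has at most
  -- b_{m+1} neighbours at distance m + 2 from `y`.
  receding-step : ∀ {x y} m → Adj x y →
                  count (receding? x y (suc m)) * c (suc m) ≤ count (receding? x y m) * b (suc m)
  receding-step {x} {y} m x~y = begin
    count R? * c (suc m)  ≤⟨ edges-≥ X R? Q? (λ z (δx≡ , δy≡) → ≤-trans (≤-reflexive (sym (c-count-layer x z δx≡)))
                               (#neighbours-⊆ X z (layer? x m) Q? λ u z~u δxu≡ → δxu≡ ,
                                 ≤-antisym (≤-trans (δ-stepˡ u (adj-sym x~y)) (≤-reflexive (cong suc δxu≡)))
                                           (≤-pred (≤-trans (≤-reflexive (sym δy≡)) (δ-stepʳ y z~u))))) ⟩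
    edges X R? Q?         ≡⟨ edges-comm X R? Q? ⟩
    edges X Q? R?         ≤⟨ edges-≤ X Q? R? (λ z (_ , δy≡) → ≤-trans
                               (#neighbours-⊆ X z R? (layer? y (2 + m)) (λ _ _ → proj₂))
                               (≤-reflexive (b-count (suc m) y z δy≡))) ⟩
    count Q? * b (suc m)  ∎
    where
    open ≤-Reasoning
    R? = receding? x y (suc m)
    Q? = receding? x y m

  -- Iterating `receding-step` bounds the count by the product of b_i / c_i over 1 ≤ i ≤ m, while
  -- κ_m is the product of b_{i-1} / c_i. The quotient telescopes to b_m / b_0.
  receding-bound : ∀ {x y} m → Adj x y → m ≤ d → count (receding? x y m) * b 0 ≤ κ x m * b m
  receding-bound {x} {y} zero    x~y _   =
    *-monoˡ-≤ (b 0) (count-⊆ (receding? x y 0) (layer? x 0) (λ _ → proj₁))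
  receding-bound {x} {y} (suc m) x~y m<d = *-cancelʳ-≤ _ _ (c (suc m)) {{>-nonZero (c-pos m<d)}} (begin
    r (suc m) * b 0 * c (suc m)        ≡⟨ swap (r (suc m)) (b 0) (c (suc m)) ⟩
    r (suc m) * c (suc m) * b 0        ≤⟨ *-monoˡ-≤ (b 0) (receding-step m x~y) ⟩
    r m * b (suc m) * b 0              ≡⟨ swap (r m) (b (suc m)) (b 0) ⟩
    r m * b 0 * b (suc m)              ≤⟨ *-monoˡ-≤ (b (suc m)) (receding-bound m x~y (<⇒≤ m<d)) ⟩
    κ x m * b m * b (suc m)            ≡⟨ cong (_* b (suc m)) (κ-rec x m) ⟩
    κ x (suc m) * c (suc m) * b (suc m) ≡⟨ swap (κ x (suc m)) (c (suc m)) (b (suc m)) ⟩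
    κ x (suc m) * b (suc m) * c (suc m) ∎)
    where
    open ≤-Reasoning
    r : ℕ → ℕ
    r i = count (receding? x y i)
    swap : ∀ p q s → p * q * s ≡ p * s * q
    swap p q s = trans (*-assoc p q s) (trans (cong (p *_) (*-comm q s)) (sym (*-assoc p s q)))

  -- The condition at `x` is `≤ m` and not equality, so that it can persist when `x` is replaced by
  -- the next vertex of the walk in `escaping-bound`.
  escaping? : ∀ x y m → U.Decidable (λ z → δ x z ≤ m × m < δ y z)
  escaping? x y m z = (δ x z ≤? m) ×-dec (m <? δ y z)

  escaping-bound : ∀ s {x y m} → Walk X s x y → m ≤ d →
                   count (escaping? x y m) * b 0 ≤ s * (κ x m * b m)
  escaping-bound zero {x} {m = m} refl m≤d
    rewrite count-∅ (escaping? x x m) (λ _ (p , q) → <⇒≱ q p) = z≤n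
  escaping-bound (suc s) {x} {y} {m} (x′ , x~x′ , p) m≤d = begin
    count (escaping? x y m) * b 0
      ≤⟨ *-monoˡ-≤ (b 0) (count-∪ (escaping? x y m) (receding? x x′ m) (escaping? x′ y m) first-exit) ⟩
    (count (receding? x x′ m) + count (escaping? x′ y m)) * b 0
      ≡⟨ *-distribʳ-+ (b 0) (count (receding? x x′ m)) _ ⟩
    count (receding? x x′ m) * b 0 + count (escaping? x′ y m) * b 0
      ≤⟨ +-mono-≤ (receding-bound m x~x′ m≤d) (escaping-bound s p m≤d) ⟩
    κ x m * b m + s * (κ x′ m * b m)
      ≡⟨ cong (λ k → κ x m * b m + s * (k * b m)) (κ-const m x′ x m≤d) ⟩
    suc s * (κ x m * b m) ∎
    where
    open ≤-Reasoning
    -- An arc changes the distance to `z` by at most one. So if `x′` is outside the m-ball about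
    -- `z`, the distance jumps from exactly m to exactly m + 1.
    first-exit : ∀ z → δ x z ≤ m × m < δ y z →
                 (δ x z ≡ m × δ x′ z ≡ suc m) ⊎ (δ x′ z ≤ m × m < δ y z)
    first-exit z (δx≤m , m<δy) with δ x′ z ≤? m
    ... | yes δx′≤m = inj₂ (δx′≤m , m<δy)
    ... | no  δx′≰m = inj₁ (≤-antisym δx≤m (≤-pred (≤-trans (≰⇒> δx′≰m) δx′≤1+δx)) ,
                            ≤-antisym (≤-trans δx′≤1+δx (s≤s δx≤m)) (≰⇒> δx′≰m))
      where δx′≤1+δx = δ-stepˡ z (adj-sym x~x′)

  -- Entering a ball along a random geodesic

  near? : ∀ u v r t → U.Decidable (λ z → δ u z ≡ t × δ v z ≤ r)
  near? u v r t z = (δ u z ≟ t) ×-dec (δ v z ≤? r)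

  near-zero : ∀ u v {r} → r < δ v u → count (near? u v r 0) ≡ 0
  near-zero u v {r} r<δ = count-∅ (near? u v r 0) λ z (δ≡0 , δ≤r) →
    <⇒≱ r<δ (subst (λ x → δ v x ≤ r) (sym (δ≡0⇒≡ δ≡0)) δ≤r)

  -- Count edges from radius t to radius t + 1 about `u` that end in the r-ball about `v`. Each
  -- endpoint has c_{t+1} predecessors; one inside the ball sends at most b_t such edges, one
  -- outside at most c_{r+1}. Dividing by κ_t b_t = κ_{t+1} c_{t+1}, the proportion inside the ball
  -- grows by at most c_{r+1} / b_t.
  near-step : ∀ u v r t → count (near? u v r (suc t)) * c (suc t)
                        ≤ count (near? u v r t) * b t + κ u t * c (suc r)
  near-step u v r t = begin
    count N⁺? * c (suc t)               ≤⟨ edges-≥ X N⁺? (layer? u t) (λ z (δu≡ , _) → ≤-reflexive (sym (c-count-layer u z δu≡))) ⟩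
    edges X N⁺? (layer? u t)            ≡⟨ edges-comm X N⁺? (layer? u t) ⟩
    edges X (layer? u t) N⁺?            ≤⟨ edges-∪ˡ X (layer? u t) N? F? N⁺? near-or-far ⟩
    edges X N? N⁺? + edges X F? N⁺?     ≤⟨ +-mono-≤ (edges-≤ X N? N⁺? from-near) (edges-≤ X F? N⁺? from-far) ⟩
    count N? * b t + count F? * c (suc r) ≤⟨ +-monoʳ-≤ (count N? * b t) (*-monoˡ-≤ (c (suc r)) (count-⊆ F? (layer? u t) (λ _ → proj₁))) ⟩
    count N? * b t + κ u t * c (suc r)  ∎
    where
    open ≤-Reasoning
    N⁺? = near? u v r (suc t)
    N?  = near? u v r t
    F? : U.Decidable (λ z → δ u z ≡ t × r < δ v z)
    F? z = (δ u z ≟ t) ×-dec (r <? δ v z)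

    near-or-far : ∀ z → δ u z ≡ t → (δ u z ≡ t × δ v z ≤ r) ⊎ (δ u z ≡ t × r < δ v z)
    near-or-far z δ≡ with δ v z ≤? r
    ... | yes δ≤r = inj₁ (δ≡ , δ≤r)
    ... | no  δ≰r = inj₂ (δ≡ , ≰⇒> δ≰r)

    from-near : ∀ z → δ u z ≡ t × δ v z ≤ r → #neighbours X z N⁺? ≤ b t
    from-near z (δ≡ , _) = ≤-trans (#neighbours-⊆ X z N⁺? (layer? u (suc t)) (λ _ _ → proj₁))
                                   (≤-reflexive (b-count t u z δ≡))

    -- Outside the r-ball only a vertex at distance exactly r + 1 from `v` has neighbours in it, and
    -- they are among its c_{r+1} neighbours nearer to `v`.
    from-far : ∀ z → δ u z ≡ t × r < δ v z → #neighbours X z N⁺? ≤ c (suc r)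
    from-far z (_ , r<δ) with δ v z ≟ suc r
    ... | yes δ≡ = ≤-trans
      (#neighbours-⊆ X z N⁺? (layer? v r) λ w z~w (_ , δ≤r) →
        ≤-antisym δ≤r (≤-pred (≤-trans (≤-reflexive (sym δ≡)) (δ-stepʳ v z~w))))
      (≤-reflexive (c-count-layer v z δ≡))
    ... | no δ≢ = ≤-trans (≤-reflexive (count-∅ (λ w → adj? z w ×-dec N⁺? w) λ w (z~w , _ , δ≤r) →
        δ≢ (≤-antisym (≤-trans (δ-stepʳ v z~w) (s≤s δ≤r)) r<δ))) z≤n

  -- A union bound over the four kinds of vertices, which may overlap. Once both distances are at
  -- most m, the distance to `u` alone separates the last two kinds.
  layer-cover : ∀ u v y m → κ y m ≤ count (escaping? y u m) + count (escaping? y v m)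
                                    + (count (near? u v m m) + count (ball? u m))
  layer-cover u v y m = begin
    κ y m                            ≤⟨ count-∪ (layer? y m) E? I? E-or-I ⟩
    count E? + count I?              ≤⟨ +-mono-≤ (count-∪ E? (escaping? y u m) (escaping? y v m) (λ _ p → p))
                                                 (count-∪ I? (near? u v m m) (ball? u m) near-or-ball) ⟩
    count (escaping? y u m) + count (escaping? y v m) + (count (near? u v m m) + count (ball? u m)) ∎
    where
    open ≤-Reasoning
    E? : U.Decidable (λ z → (δ y z ≤ m × m < δ u z) ⊎ (δ y z ≤ m × m < δ v z))
    E? z = escaping? y u m z ⊎-dec escaping? y v m z
    I? : U.Decidable (λ z → δ u z ≤ m × δ v z ≤ m)
    I? z = (δ u z ≤? m) ×-dec (δ v z ≤? m)

    E-or-I : ∀ z → δ y z ≡ m → ((δ y z ≤ m × m < δ u z) ⊎ (δ y z ≤ m × m < δ v z)) ⊎ (δ u z ≤ m × δ v z ≤ m)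
    E-or-I z δ≡ with δ u z ≤? m | δ v z ≤? m
    ... | no p  | _     = inj₁ (inj₁ (≤-reflexive δ≡ , ≰⇒> p))
    ... | yes _ | no q  = inj₁ (inj₂ (≤-reflexive δ≡ , ≰⇒> q))
    ... | yes p | yes q = inj₂ (p , q)

    near-or-ball : ∀ z → δ u z ≤ m × δ v z ≤ m → (δ u z ≡ m × δ v z ≤ m) ⊎ δ u z < m
    near-or-ball z (p , q) with m≤n⇒m<n∨m≡n p
    ... | inj₁ δ<m = inj₂ δ<m
    ... | inj₂ δ≡m = inj₁ (δ≡m , q)

  -- The bounds as proportions of a sphere

  H : ℕ → ℚ
  H m = Σ[1≤ t ≤ m ] 1ℚ ⊘ fromℕ (b (t ∸ 1))

  -- Each of the s terms b_0 / b_{t-1} is at least 1, as the b_i do not increase.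
  fromℕ≤b₀H : ∀ {s} → s ≤ d → fromℕ s ℚ.≤ fromℕ (b 0) ℚ.* H s
  fromℕ≤b₀H {zero}  _   = ℚ.≤-reflexive (sym (ℚ.*-zeroʳ (fromℕ (b 0))))
  fromℕ≤b₀H {suc s} s<d = begin
    fromℕ (suc s)                                  ≡⟨ cong fromℕ (+-comm 1 s) ⟩
    fromℕ (s + 1)                                  ≡⟨ fromℕ-homo-+ s 1 ⟩
    fromℕ s ℚ.+ 1ℚ                                 ≡⟨ cong (fromℕ s ℚ.+_) (q*p⊘q≡p 1ℚ (fromℕ (b s))) ⟨
    fromℕ s ℚ.+ fromℕ (b s) ℚ.* h                  ≤⟨ ℚ.+-mono-≤ (fromℕ≤b₀H (<⇒≤ s<d)) (ℚ.*-monoʳ-≤-nonNeg h (fromℕ-mono-≤ (b-antitone z≤n (<⇒≤ s<d)))) ⟩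
    fromℕ (b 0) ℚ.* H s ℚ.+ fromℕ (b 0) ℚ.* h      ≡⟨ ℚ.*-distribˡ-+ (fromℕ (b 0)) (H s) h ⟨
    fromℕ (b 0) ℚ.* H (suc s)                      ∎
    where
    open ℚ.≤-Reasoning
    h = 1ℚ ⊘ fromℕ (b s)
    instance
      bₛ>0 = fromℕ-pos (b-pos s<d)
      h≥0  = ⊘-nonNeg 1ℚ (fromℕ (b s))

  -- This is `escaping-bound` divided by b_0, with s / b_0 replaced by the larger `H s`.
  escaping-fraction : ∀ {s x y m} → Walk X s x y → s ≤ d → 0 < d → m ≤ d →
    fromℕ (count (escaping? x y m)) ℚ.≤ fromℕ (κ x m) ℚ.* (fromℕ (b m) ℚ.* H s)
  escaping-fraction {s} {x} {y} {m} p s≤d 0<d m≤d = ℚ.*-cancelʳ-≤-pos (fromℕ (b 0)) (begin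
    fromℕ e ℚ.* fromℕ (b 0)                                        ≡⟨ fromℕ-homo-* e (b 0) ⟨
    fromℕ (e * b 0)                                                ≤⟨ fromℕ-mono-≤ (escaping-bound s p m≤d) ⟩
    fromℕ (s * (κ x m * b m))                                      ≡⟨ fromℕ-homo-* s (κ x m * b m) ⟩
    fromℕ s ℚ.* fromℕ (κ x m * b m)                                ≤⟨ ℚ.*-monoʳ-≤-nonNeg (fromℕ (κ x m * b m)) {{fromℕ-nonNeg (κ x m * b m)}} (fromℕ≤b₀H s≤d) ⟩
    fromℕ (b 0) ℚ.* H s ℚ.* fromℕ (κ x m * b m)                    ≡⟨ cong (fromℕ (b 0) ℚ.* H s ℚ.*_) (fromℕ-homo-* (κ x m) (b m)) ⟩
    fromℕ (b 0) ℚ.* H s ℚ.* (fromℕ (κ x m) ℚ.* fromℕ (b m))        ≡⟨ solve 4 (λ b₀ h k bₘ → b₀ :* h :* (k :* bₘ) := k :* (bₘ :* h) :* b₀) refl (fromℕ (b 0)) (H s) (fromℕ (κ x m)) (fromℕ (b m)) ⟩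
    fromℕ (κ x m) ℚ.* (fromℕ (b m) ℚ.* H s) ℚ.* fromℕ (b 0)        ∎)
    where
    open ℚ.≤-Reasoning
    open +-*-Solver
    e = count (escaping? x y m)
    instance b₀>0 = fromℕ-pos (b-pos 0<d)

  -- Sums the increments of `near-step`. The initial proportion is 0 because `u` lies outside the
  -- r-ball about `v`.
  near-fraction : ∀ {u v r} t → r < δ v u → t ≤ d →
    fromℕ (count (near? u v r t)) ℚ.≤ fromℕ (κ u t) ℚ.* (fromℕ (c (suc r)) ℚ.* H t)
  near-fraction {u} {v} {r} zero r<δ _ rewrite near-zero u v r<δ = ℚ.≤-reflexive
    (sym (trans (cong (fromℕ (κ u 0) ℚ.*_) (ℚ.*-zeroʳ (fromℕ (c (suc r))))) (ℚ.*-zeroʳ (fromℕ (κ u 0)))))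
  near-fraction {u} {v} {r} (suc t) r<δ t<d = ℚ.*-cancelʳ-≤-pos (fromℕ (c (suc t))) (begin
    fromℕ (N (suc t)) ℚ.* fromℕ (c (suc t))    ≡⟨ fromℕ-homo-* (N (suc t)) (c (suc t)) ⟨
    fromℕ (N (suc t) * c (suc t))              ≤⟨ fromℕ-mono-≤ (near-step u v r t) ⟩
    fromℕ (N t * b t + κ u t * c (suc r))      ≡⟨ fromℕ-homo-+ (N t * b t) _ ⟩
    fromℕ (N t * b t) ℚ.+ fromℕ (κ u t * c (suc r))
      ≡⟨ cong₂ ℚ._+_ (fromℕ-homo-* (N t) (b t)) (trans (fromℕ-homo-* (κ u t) (c (suc r))) (sym (ℚ.*-identityʳ (k ℚ.* g)))) ⟩
    fromℕ (N t) ℚ.* bₜ ℚ.+ k ℚ.* g ℚ.* 1ℚ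
      ≤⟨ ℚ.+-monoˡ-≤ (k ℚ.* g ℚ.* 1ℚ) (ℚ.*-monoʳ-≤-nonNeg bₜ {{fromℕ-nonNeg (b t)}} (near-fraction t r<δ (<⇒≤ t<d))) ⟩
    k ℚ.* (g ℚ.* H t) ℚ.* bₜ ℚ.+ k ℚ.* g ℚ.* 1ℚ
      -- Writing 1 as b_t times its reciprocal gives both summands the factor κ_t b_t, which `κ-rec`
      -- turns into κ_{t+1} c_{t+1}.
      ≡⟨ cong (λ q → k ℚ.* (g ℚ.* H t) ℚ.* bₜ ℚ.+ k ℚ.* g ℚ.* q) (q*p⊘q≡p 1ℚ bₜ) ⟨
    k ℚ.* (g ℚ.* H t) ℚ.* bₜ ℚ.+ k ℚ.* g ℚ.* (bₜ ℚ.* h)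
      ≡⟨ solve 5 (λ k g s b h → k :* (g :* s) :* b :+ k :* g :* (b :* h) := (k :* b) :* (g :* (s :+ h))) refl k g (H t) bₜ h ⟩
    (k ℚ.* bₜ) ℚ.* (g ℚ.* H (suc t))
      ≡⟨ cong (ℚ._* (g ℚ.* H (suc t))) (trans (sym (fromℕ-homo-* (κ u t) (b t))) (trans (cong fromℕ (κ-rec u t)) (fromℕ-homo-* (κ u (suc t)) (c (suc t))))) ⟩
    (k⁺ ℚ.* fromℕ (c (suc t))) ℚ.* (g ℚ.* H (suc t))
      ≡⟨ solve 3 (λ k c g → k :* c :* g := k :* g :* c) refl k⁺ (fromℕ (c (suc t))) (g ℚ.* H (suc t)) ⟩
    k⁺ ℚ.* (g ℚ.* H (suc t)) ℚ.* fromℕ (c (suc t)) ∎)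
    where
    open ℚ.≤-Reasoning
    open +-*-Solver
    N : ℕ → ℕ
    N i = count (near? u v r i)
    k  = fromℕ (κ u t)
    k⁺ = fromℕ (κ u (suc t))
    g  = fromℕ (c (suc r))
    bₜ = fromℕ (b t)
    h  = 1ℚ ⊘ bₜ
    instance
      bₜ>0 = fromℕ-pos (b-pos t<d)
      cₜ>0 = fromℕ-pos (c-pos t<d)

  ball-fraction : ∀ {j} v → j < d → c (suc j) < b j →
    fromℕ (count (ball? v (suc j))) ℚ.≤
      fromℕ (κ v (suc j)) ℚ.* (fromℕ 4 ⊘ (fromℕ (b j) ⊘ fromℕ (c (suc j)) ℚ.- 1ℚ))
  ball-fraction {j} v j<d c<b = ℚ.*-cancelʳ-≤-pos x (begin
    B ℚ.* x                          ≤⟨ ℚ.*-cancelˡ-≤-pos γ γBx≤γk ⟩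
    k                                ≡⟨ ℚ.*-identityʳ k ⟨
    -- The count itself gives 1 / (C - 1); the constant 4 enters here as a weakening.
    k ℚ.* 1ℚ                         ≤⟨ ℚ.*-monoˡ-≤-nonNeg k {{fromℕ-nonNeg (κ v (suc j))}} (fromℕ-mono-≤ {1} {4} (s≤s z≤n)) ⟩
    k ℚ.* fromℕ 4                    ≡⟨ cong (k ℚ.*_) (q*p⊘q≡p (fromℕ 4) x) ⟨
    k ℚ.* (x ℚ.* (fromℕ 4 ⊘ x))      ≡⟨ solve 3 (λ k x w → k :* (x :* w) := k :* w :* x) refl k x (fromℕ 4 ⊘ x) ⟩
    k ℚ.* (fromℕ 4 ⊘ x) ℚ.* x        ∎)
    where
    open ℚ.≤-Reasoning
    open +-*-Solver
    γ = fromℕ (c (suc j))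
    C = fromℕ (b j) ⊘ γ
    x = C ℚ.- 1ℚ
    B = fromℕ (count (ball? v (suc j)))
    k = fromℕ (κ v (suc j))
    e = b j ∸ c (suc j)
    instance
      γ>0 : Positive γ
      γ>0 = fromℕ-pos (c-pos j<d)

    -- The truncated difference `e` is exact by `c<b`. The identity connects `ball-bound` with C - 1
    -- and shows that C - 1 is positive, so that `fromℕ 4 ⊘ x` is a genuine quotient.
    γx≡e : γ ℚ.* x ≡ fromℕ e
    γx≡e = begin-equality
      γ ℚ.* x                         ≡⟨ solve 2 (λ g c → g :* (c :- con 1ℚ) := g :* c :- g) refl γ C ⟩
      γ ℚ.* C ℚ.- γ                   ≡⟨ cong (ℚ._- γ) (q*p⊘q≡p (fromℕ (b j)) γ) ⟩
      fromℕ (b j) ℚ.- γ               ≡⟨ cong (λ m → fromℕ m ℚ.- γ) (m∸n+n≡m (<⇒≤ c<b)) ⟨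
      fromℕ (e + c (suc j)) ℚ.- γ     ≡⟨ cong (ℚ._- γ) (fromℕ-homo-+ e (c (suc j))) ⟩
      fromℕ e ℚ.+ γ ℚ.- γ             ≡⟨ solve 2 (λ e g → e :+ g :- g := e) refl (fromℕ e) γ ⟩
      fromℕ e                         ∎

    instance
      x>0 : Positive x
      x>0 = positive (ℚ.*-cancelˡ-<-nonNeg γ {{fromℕ-nonNeg (c (suc j))}} (begin-strict
        γ ℚ.* 0ℚ   ≡⟨ ℚ.*-zeroʳ γ ⟩
        0ℚ         <⟨ ℚ.positive⁻¹ (fromℕ e) {{fromℕ-pos (m<n⇒0<n∸m c<b)}} ⟩
        fromℕ e    ≡⟨ γx≡e ⟨
        γ ℚ.* x    ∎))

    γBx≤γk : γ ℚ.* (B ℚ.* x) ℚ.≤ γ ℚ.* k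
    γBx≤γk = begin
      γ ℚ.* (B ℚ.* x)                         ≡⟨ solve 3 (λ g B x → g :* (B :* x) := B :* (g :* x)) refl γ B x ⟩
      B ℚ.* (γ ℚ.* x)                         ≡⟨ cong (B ℚ.*_) γx≡e ⟩
      B ℚ.* fromℕ e                           ≡⟨ fromℕ-homo-* (count (ball? v (suc j))) e ⟨
      fromℕ (count (ball? v (suc j)) * e)     ≤⟨ fromℕ-mono-≤ (ball-bound v (suc j) j<d ≤-refl (<⇒≤ c<b)) ⟩
      fromℕ (κ v (suc j) * c (suc j))         ≡⟨ fromℕ-homo-* (κ v (suc j)) (c (suc j)) ⟩
      k ℚ.* γ                                 ≡⟨ ℚ.*-comm k γ ⟩
      γ ℚ.* k                                 ∎

-- Assembling the four estimates

theorem3p2 :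
    ∀ {n : ℕ} (X : SimpleGraph n) (d : ℕ) (a b c : ℕ → ℕ) →
    IsDistanceRegular X d a b c → 2 ≤ d →
    ∀ (j : ℕ) → j ≤ d ∸ 2 → c (1 + j) < b j →
    let C : ℚ
        C = fromℕ (b j) ⊘ fromℕ (c (1 + j))
    in
    ∀ (s : ℕ) → 1 ≤ s → s ≤ 1 + j →
    fromℕ (b (1 + j)) ℚ.* ((Σ[1≤ t ≤ s ] 1ℚ ⊘ fromℕ (b (t ∸ 1))) ℚ.+ (Σ[1≤ t ≤ (2 + j) ∸ s ] 1ℚ ⊘ fromℕ (b (t ∸ 1))))
      ℚ.+ fromℕ (c (2 + j)) ℚ.* (Σ[1≤ t ≤ 1 + j ] 1ℚ ⊘ fromℕ (b (t ∸ 1)))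
    ℚ.≥ 1ℚ ℚ.- fromℕ 4 ⊘ (C ℚ.- 1ℚ)
theorem3p2 X d a b c D 2≤d j j≤d-2 c<b s _ s≤1+j
  -- By `2≤d` the subtraction in `d ∸ 2` is exact, so j + 2 ≤ d and a pair at distance j + 2 exists.
  with DistanceRegular.distance-attained X D (subst (2 + j ≤_) (m+[n∸m]≡n 2≤d) (+-monoʳ-≤ 2 j≤d-2))
-- Cut the geodesic at `y`, at j + 2 - s steps from `v` and s steps from `u`. The two pieces produce
-- the two sums multiplied by b_{j+1}.
... | v , u , δ≡ with walk-split X (2 + j ∸ s) s
                        (subst (λ k → Walk X k v u) (trans δ≡ (sym (m∸n+n≡m (m≤n⇒m≤1+n s≤1+j)))) (DistanceRegular.δ-walk X D v u))
... | y , v⇝y , y⇝u = begin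
  -- The sphere about `y` is nonempty, so its size `k` cancels.
  1ℚ ℚ.- W                       ≤⟨ ℚ.+-monoˡ-≤ (ℚ.- W) (ℚ.*-cancelˡ-≤-pos k {{fromℕ-pos (κ-pos y m≤d)}} k≤kL+W) ⟩
  L ℚ.+ W ℚ.- W                  ≡⟨ solve 2 (λ l w → l :+ w :- w := l) refl L W ⟩
  L                              ∎
  where
  open DistanceRegular X D
  open ℚ.≤-Reasoning
  open +-*-Solver
  m = 1 + j
  s′ = 2 + j ∸ s
  k = fromℕ (κ y m)
  β = fromℕ (b m)
  γ = fromℕ (c (2 + j))
  W = fromℕ 4 ⊘ (fromℕ (b j) ⊘ fromℕ (c (1 + j)) ℚ.- 1ℚ)
  L = β ℚ.* (H s ℚ.+ H s′) ℚ.+ γ ℚ.* H m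

  m<d : m < d
  m<d = subst (2 + j ≤_) (m+[n∸m]≡n 2≤d) (+-monoʳ-≤ 2 j≤d-2)
  m≤d : m ≤ d
  m≤d = <⇒≤ m<d
  0<d : 0 < d
  0<d = ≤-trans (s≤s z≤n) 2≤d

  k′≡k : fromℕ (κ u m) ≡ k
  k′≡k = cong fromℕ (κ-const m u y m≤d)

  E₁ = count (escaping? y u m)
  E₂ = count (escaping? y v m)
  N  = count (near? u v m m)
  B  = count (ball? u m)

  k≤kL+W : k ℚ.* 1ℚ ℚ.≤ k ℚ.* (L ℚ.+ W)
  k≤kL+W = begin
    k ℚ.* 1ℚ                                ≡⟨ ℚ.*-identityʳ k ⟩
    k                                       ≤⟨ fromℕ-mono-≤ (layer-cover u v y m) ⟩
    fromℕ (E₁ + E₂ + (N + B))               ≡⟨ fromℕ-homo-+ (E₁ + E₂) (N + B) ⟩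
    fromℕ (E₁ + E₂) ℚ.+ fromℕ (N + B)       ≡⟨ cong₂ ℚ._+_ (fromℕ-homo-+ E₁ E₂) (fromℕ-homo-+ N B) ⟩
    (fromℕ E₁ ℚ.+ fromℕ E₂) ℚ.+ (fromℕ N ℚ.+ fromℕ B)
      ≤⟨ ℚ.+-mono-≤
           (ℚ.+-mono-≤ (escaping-fraction y⇝u (≤-trans s≤1+j m≤d) 0<d m≤d)
                       (escaping-fraction (walk-reverse X s′ v⇝y) (≤-trans (m∸n≤m (2 + j) s) m<d) 0<d m≤d))
           -- These two bounds refer to the sphere about `u`, which also has size `k`. The random
           -- geodesic starts outside the m-ball about `v` because `δ v u` is m + 1.
           (ℚ.+-mono-≤ (subst (λ q → fromℕ N ℚ.≤ q ℚ.* (γ ℚ.* H m)) k′≡k (near-fraction m (≤-reflexive (sym δ≡)) m≤d))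
                       (subst (λ q → fromℕ B ℚ.≤ q ℚ.* W) k′≡k (ball-fraction u m≤d c<b))) ⟩
    (k ℚ.* (β ℚ.* H s) ℚ.+ k ℚ.* (β ℚ.* H s′)) ℚ.+ (k ℚ.* (γ ℚ.* H m) ℚ.+ k ℚ.* W)
      ≡⟨ solve 7 (λ k β γ s s′ m w → (k :* (β :* s) :+ k :* (β :* s′)) :+ (k :* (γ :* m) :+ k :* w)
                                     := k :* (β :* (s :+ s′) :+ γ :* m :+ w)) refl k β γ (H s) (H s′) (H m) W ⟩
    k ℚ.* (L ℚ.+ W)                         ∎
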